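{- If $n\ge 1$ is odd, then $a_{2(2)}(n)=b_2(2n+1,n+1)$. More generally, let $m,\ell\geq 2$ and let $n\ge1$ be not divisible by $\ell$, with $n=\ell k+r$ for integers $k$ and $1\leq r<\ell$. Then \[a_{m(\ell)}(n)=a_{(m-1)(\ell)}(2n+\ell-r,\,n+\ell-r).\]
   Context: An $\ell$-regular partition is a partition with no part divisible by $\ell$. $a_{m(\ell)}(n)$ is the number of $\ell$-regular partitions of $n$ in which the smallest part occurs at least $m$ times. $a_{m(\ell)}(N,j)$ is the number of $\ell$-regular partitions of $N$ in which the smallest part occurs at least $m$ times and the largest part minus the smallest part equals $j$. $b_\ell(N,j)$ is the number of $\ell$-regular partitions of $N$ in which the largest part minus the smallest part equals $j$. -}

module Defs where

open import Data.Nat.Base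
open import Data.Nat.Properties using (_≟_; _≤?_; _≥?_; suc-injective)
open import Data.Nat.Divisibility using (_∣_; _∣?_)
open import Data.List.Base using (List; []; _∷_; length; filter; concatMap; map)
open import Data.Nat.ListAction using (sum)
open import Data.List.Extrema.Nat using (min; max)
open import Data.List.Membership.Propositional using (_∈_; find; lose)
open import Data.List.Membership.Propositional.Properties
  using (∈-filter⁺; ∈-filter⁻; ∈-concatMap⁺; ∈-concatMap⁻)
open import Data.List.Relation.Unary.All as All using (All; []; _∷_; all?)
open import Data.List.Relation.Unary.AllPairs using (AllPairs; []; _∷_)
import Data.List.Relation.Unary.All.Properties as All
open import Data.List.Relation.Unary.Any using (here; there)
open import Data.List.Relation.Unary.Linked using (Linked; linked?)
open import Data.List.Relation.Unary.Unique.Propositional using (Unique)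
import Data.List.Relation.Unary.Unique.Propositional.Properties as Unique
open import Data.List.Relation.Binary.Disjoint.Propositional using (Disjoint)
open import Data.Product.Base using (_×_; _,_; proj₁)
open import Function.Base using (_∘_)
open import Relation.Nullary using (¬_; Dec; ¬?; _×-dec_)
open import Relation.Binary.PropositionalEquality

record IsPartition (n : ℕ) (ps : List ℕ) : Set where
  constructor isPartition
  field
    decreasing : Linked _≥_ ps
    positive   : All (1 ≤_) ps
    total      : sum ps ≡ n

-- A composition of suc n arises from exactly one composition of n, by
-- prepending a part 1 or by enlarging the first part by 1.

extend : List ℕ → List (List ℕ)
extend []       = (1 ∷ []) ∷ []
extend (p ∷ ps) = (1 ∷ p ∷ ps) ∷ (suc p ∷ ps) ∷ []

compositions : ℕ → List (List ℕ)
compositions zero    = [] ∷ []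
compositions (suc n) = concatMap extend (compositions n)

-- Each partition of n appears exactly once: see ∈-partitions⁺,
-- ∈-partitions⁻ and partitions-unique below.

partitions : ℕ → List (List ℕ)
partitions n = filter (linked? _≥?_) (compositions n)

-- The empty list has no smallest part; 0 is a dummy value.  It is a
-- partition of 0 only, so it matters for no positive n.

smallest : List ℕ → ℕ
smallest []       = 0
smallest (p ∷ ps) = min p ps

largest : List ℕ → ℕ
largest = max 0

occurrences : ℕ → List ℕ → ℕ
occurrences p = length ∘ filter (_≟ p)

Regular : ℕ → List ℕ → Set
Regular ℓ = All (λ p → ¬ ℓ ∣ p)

SmallestOccurs≥ : ℕ → List ℕ → Set
SmallestOccurs≥ m ps = m ≤ occurrences (smallest ps) ps

-- largest − smallest = j, written without truncated subtraction.

Spread : ℕ → List ℕ → Set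
Spread j ps = largest ps ≡ smallest ps + j

regular? : ∀ ℓ ps → Dec (Regular ℓ ps)
regular? ℓ = all? (λ p → ¬? (ℓ ∣? p))

smallestOccurs≥? : ∀ m ps → Dec (SmallestOccurs≥ m ps)
smallestOccurs≥? m ps = m ≤? occurrences (smallest ps) ps

spread? : ∀ j ps → Dec (Spread j ps)
spread? j ps = largest ps ≟ smallest ps + j

-- a m ℓ n is a_{m(ℓ)}(n), aDiff m ℓ N j is a_{m(ℓ)}(N, j), and
-- b ℓ N j is b_ℓ(N, j).

a : (m ℓ n : ℕ) → ℕ
a m ℓ n =
  length (filter (λ ps → regular? ℓ ps ×-dec smallestOccurs≥? m ps) (partitions n))

aDiff : (m ℓ N j : ℕ) → ℕ
aDiff m ℓ N j =
  length (filter (λ ps → regular? ℓ ps ×-dec smallestOccurs≥? m ps ×-dec spread? j ps)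
                 (partitions N))

b : (ℓ N j : ℕ) → ℕ
b ℓ N j =
  length (filter (λ ps → regular? ℓ ps ×-dec spread? j ps) (partitions N))

∈-compositions⁺ : ∀ n {ps} → All (1 ≤_) ps → sum ps ≡ n → ps ∈ compositions n
∈-compositions⁺ zero    {[]}               _         _  = here refl
∈-compositions⁺ zero    {suc _ ∷ _}        _         ()
∈-compositions⁺ zero    {zero ∷ _}         (() ∷ _)  _
∈-compositions⁺ (suc n) {zero ∷ _}         (() ∷ _)  _
∈-compositions⁺ (suc n) {suc zero ∷ []}    _         eq =
  ∈-concatMap⁺ extend (lose (∈-compositions⁺ n {[]} [] (suc-injective eq)) (here refl))
∈-compositions⁺ (suc n) {suc zero ∷ p ∷ ps} (_ ∷ pos) eq =
  ∈-concatMap⁺ extend (lose (∈-compositions⁺ n pos (suc-injective eq)) (here refl))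
∈-compositions⁺ (suc n) {suc (suc p) ∷ ps} (_ ∷ pos) eq =
  ∈-concatMap⁺ extend
    (lose (∈-compositions⁺ n (s≤s z≤n ∷ pos) (suc-injective eq)) (there (here refl)))

∈-extend⁻ : ∀ {n} qs {ps} → ps ∈ extend qs → All (1 ≤_) qs → sum qs ≡ n →
            All (1 ≤_) ps × sum ps ≡ suc n
∈-extend⁻ []       (here refl)         pos       eq = s≤s z≤n ∷ [] , cong suc eq
∈-extend⁻ (q ∷ qs) (here refl)         pos       eq = s≤s z≤n ∷ pos , cong suc eq
∈-extend⁻ (q ∷ qs) (there (here refl)) (_ ∷ pos) eq = s≤s z≤n ∷ pos , cong suc eq

∈-compositions⁻ : ∀ n {ps} → ps ∈ compositions n → All (1 ≤_) ps × sum ps ≡ n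
∈-compositions⁻ zero    (here refl) = [] , refl
∈-compositions⁻ (suc n) ps∈
  with qs , qs∈ , ps∈qs ← find (∈-concatMap⁻ extend {xs = compositions n} ps∈)
  with pos , eq ← ∈-compositions⁻ n qs∈ = ∈-extend⁻ qs ps∈qs pos eq

shrink : List ℕ → List ℕ
shrink (suc (suc p) ∷ ps) = suc p ∷ ps
shrink (_ ∷ ps)           = ps
shrink []                 = []

shrink-extend : ∀ qs {ps} → All (1 ≤_) qs → ps ∈ extend qs → shrink ps ≡ qs
shrink-extend []           _ (here refl)         = refl
shrink-extend (q ∷ qs)     _ (here refl)         = refl
shrink-extend (suc q ∷ qs) _ (there (here refl)) = refl
shrink-extend (zero ∷ qs) (() ∷ _) (there (here refl))

extend-unique : ∀ qs → All (1 ≤_) qs → Unique (extend qs)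
extend-unique []           _        = [] ∷ []
extend-unique (suc q ∷ qs) _        = ((λ ()) ∷ []) ∷ [] ∷ []
extend-unique (zero ∷ qs)  (() ∷ _)

extend-disjoint : ∀ {xss} → All (All (1 ≤_)) xss → Unique xss →
                  AllPairs Disjoint (map extend xss)
extend-disjoint []           []         = []
extend-disjoint (pos ∷ poss) (x∉ ∷ uniq) =
  All.map⁺ (All.zipWith (λ {ys} → disjoint {ys}) (poss , x∉)) ∷ extend-disjoint poss uniq
  where
  disjoint : ∀ {ys} → All (1 ≤_) ys × _ ≢ ys → Disjoint (extend _) (extend ys)
  disjoint (posʸ , x≢y) (∈x , ∈y) =
    x≢y (trans (sym (shrink-extend _ pos ∈x)) (shrink-extend _ posʸ ∈y))

compositions-unique : ∀ n → Unique (compositions n)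
compositions-unique zero    = [] ∷ []
compositions-unique (suc n) =
  Unique.concat⁺ (All.map⁺ (All.map (extend-unique _) poss))
                 (extend-disjoint poss (compositions-unique n))
  where
  poss : All (All (1 ≤_)) (compositions n)
  poss = All.tabulate (proj₁ ∘ ∈-compositions⁻ n)

∈-partitions⁺ : ∀ {n ps} → IsPartition n ps → ps ∈ partitions n
∈-partitions⁺ {n} (isPartition dec pos eq) =
  ∈-filter⁺ (linked? _≥?_) (∈-compositions⁺ n pos eq) dec

∈-partitions⁻ : ∀ {n ps} → ps ∈ partitions n → IsPartition n ps
∈-partitions⁻ {n} ps∈
  with ps∈c , dec ← ∈-filter⁻ (linked? _≥?_) {xs = compositions n} ps∈
  with pos , eq ← ∈-compositions⁻ n ps∈c = isPartition dec pos eq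

partitions-unique : ∀ n → Unique (partitions n)
partitions-unique n = Unique.filter⁺ (linked? _≥?_) (compositions-unique n)

{-# OPTIONS --safe #-}

-- Put d = n + (ℓ ∸ r), a positive multiple of ℓ with n ≤ d.  In a partition of
-- n whose smallest part s occurs at least m ≥ 2 times, move one copy of s to
-- the front as the new largest part s + d.  All old parts are at most n ≤ s + d,
-- so the result is a partition of n + d with smallest part s, spread d and one
-- copy of s fewer; ℓ-regularity is unaffected since ℓ ∣ d.  The inverse
-- subtracts d from the largest part and moves it to the end.

module Submission where

open import Defs
open import Data.Nat.Base using (ℕ; _+_; _*_; _∸_; _≤_; _<_; _≥_; _%_)
open import Data.Nat.Divisibility using (_∣_)
open import Data.Integer.Base as ℤ using (ℤ; +_)
open import Data.Product.Base using (_×_)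
open import Relation.Nullary using (¬_)
open import Relation.Binary.PropositionalEquality using (_≡_)

open import Data.Nat.Base using (suc; z≤n; s≤s; _/_)
open import Data.Nat.Properties
open import Data.Nat.Divisibility using (divides; ∣m∣n⇒∣m+n; ∣m+n∣m⇒∣n)
open import Data.Nat.DivMod using (m≡m%n+[m/n]*n)
open import Data.Nat.ListAction using (sum)
open import Data.Nat.ListAction.Properties using (sum-++)
open import Data.Nat.Solver using (module +-*-Solver)
import Data.Integer.Properties as ℤ
open import Data.List.Base
  using (List; []; _∷_; _∷ʳ_; _++_; length; filter; map; initLast; _∷ʳ′_)
open import Data.List.Properties
  using (length-map; length-++; filter-++; filter-accept; filter-reject; filter-some;
         filter-≐; ∷ʳ-injective)
open import Data.List.Extrema.Nat
  using (min≤⊤; min≤xs; v≤min⁺; min≈v⁺; argmin-sel; max≤v⁺; v≤max⁺)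
open import Data.List.Membership.Propositional using (_∈_; lose)
open import Data.List.Membership.Propositional.Properties
  using (∈-map⁺; ∈-map⁻; ∈-filter⁺; ∈-filter⁻; ∈-++⁺ʳ)
open import Data.List.Membership.Propositional.Properties.WithK using (unique∧set⇒bag)
open import Data.List.Relation.Binary.BagAndSetEquality using (∼bag⇒↭)
open import Data.List.Relation.Binary.Permutation.Propositional.Properties using (↭-length)
open import Data.List.Relation.Unary.All as All using (All; []; _∷_)
import Data.List.Relation.Unary.All.Properties as All
open import Data.List.Relation.Unary.AllPairs using (AllPairs; []; _∷_)
import Data.List.Relation.Unary.AllPairs.Properties as AllPairs
open import Data.List.Relation.Unary.Any using (here; there)
open import Data.List.Relation.Unary.Linked using (Linked)
open import Data.List.Relation.Unary.Linked.Properties using (Linked⇒AllPairs; AllPairs⇒Linked)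
open import Data.List.Relation.Unary.Unique.Propositional using (Unique)
import Data.List.Relation.Unary.Unique.Propositional.Properties as Unique
open import Data.Product.Base using (∃; _,_; proj₂)
open import Data.Sum.Base using (inj₁; inj₂)
open import Function.Base using (_∘_; id)
open import Function.Bundles using (mk⇔)
open import Level using (Level)
open import Relation.Binary.Core using (Rel)
open import Relation.Binary.PropositionalEquality
  using (_≢_; refl; sym; trans; cong; subst; module ≡-Reasoning)
open import Relation.Nullary using (contradiction; _×-dec_)
open import Relation.Unary using (Decidable)

-- Counting by bijections, and decreasing lists.

private
  variable
    ℓ₁ ℓ₂ : Level
    A : Set ℓ₁
    B : Set ℓ₂

-- Injectivity is asked only between members of `xs`, because truncated subtraction makes `lower`
-- injective only on `Dom`.
map-unique : ∀ {f : A → B} {xs} → (∀ {x y} → x ∈ xs → y ∈ xs → f x ≡ f y → x ≡ y) →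
             Unique xs → Unique (map f xs)
map-unique inj []           = []
map-unique inj (x∉ ∷ uniq) =
  All.map⁺ (All.tabulate λ y∈ eq → All.lookup x∉ y∈ (inj (here refl) (there y∈) eq))
  ∷ map-unique (λ x∈ y∈ → inj (there x∈) (there y∈)) uniq

-- `map f xs` and `ys` are duplicate-free with the same members, hence permutations of each other.
length-bijection : ∀ {xs : List A} {ys : List B} (f : A → B) → Unique xs → Unique ys →
                   (∀ {x} → x ∈ xs → f x ∈ ys) →
                   (∀ {x y} → x ∈ xs → y ∈ xs → f x ≡ f y → x ≡ y) →
                   (∀ {y} → y ∈ ys → ∃ λ x → x ∈ xs × y ≡ f x) →
                   length xs ≡ length ys
length-bijection {xs = xs} {ys} f uniqˣ uniqʸ into inj onto =
  trans (sym (length-map f xs))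
        (↭-length (∼bag⇒↭ (unique∧set⇒bag (map-unique inj uniqˣ) uniqʸ (mk⇔ to from))))
  where
  to : ∀ {y} → y ∈ map f xs → y ∈ ys
  to y∈ with x , x∈ , refl ← ∈-map⁻ f y∈ = into x∈

  from : ∀ {y} → y ∈ ys → y ∈ map f xs
  from y∈ with x , x∈ , refl ← onto y∈ = ∈-map⁺ f x∈

AllPairs-∷ʳ⁻ : ∀ {R : Rel A ℓ₂} xs {x} → AllPairs R (xs ∷ʳ x) →
               AllPairs R xs × All (λ y → R y x) xs
AllPairs-∷ʳ⁻ []       _            = [] , []
AllPairs-∷ʳ⁻ (y ∷ ys) (Ry ∷ pairs)
  with Rys , Ryx ← All.∷ʳ⁻ Ry
  with pairs′ , Rx ← AllPairs-∷ʳ⁻ ys pairs = Rys ∷ pairs′ , Ryx ∷ Rx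

-- Passing from adjacent to arbitrary pairs allows the first and the last part to be compared with
-- every other part.
decreasing⇒AllPairs : ∀ {ps} → Linked _≥_ ps → AllPairs _≥_ ps
decreasing⇒AllPairs = Linked⇒AllPairs (λ p≥q q≥r → ≤-trans q≥r p≥q)

∈⇒≤sum : ∀ {x xs} → x ∈ xs → x ≤ sum xs
∈⇒≤sum               (here refl) = m≤m+n _ _
∈⇒≤sum {xs = y ∷ _} (there x∈)  = ≤-trans (∈⇒≤sum x∈) (m≤n+m _ y)

sum-∷ʳ : ∀ xs x → sum (xs ∷ʳ x) ≡ sum xs + x
sum-∷ʳ xs x = trans (sum-++ xs (x ∷ [])) (cong (λ y → sum xs + y) (+-identityʳ x))

-- Smallest part, largest part and multiplicities.

smallest-≤ : ∀ ps → All (smallest ps ≤_) ps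
smallest-≤ []       = []
smallest-≤ (p ∷ ps) = min≤⊤ p ps ∷ min≤xs p ps

smallest-∈ : ∀ p ps → smallest (p ∷ ps) ∈ p ∷ ps
smallest-∈ p ps with argmin-sel id p ps
... | inj₁ eq  = here eq
... | inj₂ ∈ps = there ∈ps

smallest-≡ : ∀ {x ps} → x ∈ ps → All (x ≤_) ps → smallest ps ≡ x
smallest-≡ {ps = p ∷ ps} (here refl) (_ ∷ x≤)   = ≤-antisym (min≤⊤ p ps) (v≤min⁺ ≤-refl x≤)
smallest-≡               (there x∈)  (x≤p ∷ x≤) = min≈v⁺ x∈ x≤ x≤p

largest-∷ : ∀ {q qs} → All (_≤ q) qs → largest (q ∷ qs) ≡ q
largest-∷ {q} {qs} ≤q =
  -- `z≤n` takes care of the default value 0 in `largest`.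
  ≤-antisym (max≤v⁺ z≤n (≤-refl ∷ ≤q)) (v≤max⁺ 0 (q ∷ qs) (inj₂ (here ≤-refl)))

∈⇒1≤occurrences : ∀ {x xs} → x ∈ xs → 1 ≤ occurrences x xs
∈⇒1≤occurrences {x} x∈ = filter-some (_≟ x) (lose x∈ refl)

1≤occurrences⇒∈ : ∀ {x} xs → 1 ≤ occurrences x xs → x ∈ xs
1≤occurrences⇒∈ {x} xs 1≤ with filter (_≟ x) xs in eq
1≤occurrences⇒∈ {x} xs () | []
1≤occurrences⇒∈ {x} xs _  | y ∷ _
  with y∈ , refl ← ∈-filter⁻ (_≟ x) {xs = xs} (subst (y ∈_) (sym eq) (here refl)) = y∈

occurrences-∷-≢ : ∀ {x y} ys → y ≢ x → occurrences x (y ∷ ys) ≡ occurrences x ys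
occurrences-∷-≢ {x} ys y≢x = cong length (filter-reject (_≟ x) y≢x)

occurrences-∷ʳ : ∀ x xs → occurrences x (xs ∷ʳ x) ≡ suc (occurrences x xs)
occurrences-∷ʳ x xs = begin
  occurrences x (xs ∷ʳ x)
    ≡⟨ cong length (filter-++ (_≟ x) xs (x ∷ [])) ⟩
  length (filter (_≟ x) xs ++ filter (_≟ x) (x ∷ []))
    ≡⟨ length-++ (filter (_≟ x) xs) ⟩
  occurrences x xs + occurrences x (x ∷ [])
    ≡⟨ cong (λ ys → occurrences x xs + length ys) (filter-accept (_≟ x) {xs = []} refl) ⟩
  occurrences x xs + 1
    ≡⟨ +-comm _ 1 ⟩
  suc (occurrences x xs) ∎
  where open ≡-Reasoning

-- Serves both directions of the bijection: moving a final smallest part away or back changes its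
-- multiplicity by exactly one.
occurrences-smallest-∷ʳ : ∀ {x xs} → All (x ≤_) xs →
  occurrences (smallest (xs ∷ʳ x)) (xs ∷ʳ x) ≡ suc (occurrences x xs)
occurrences-smallest-∷ʳ {x} {xs} x≤xs =
  trans (cong (λ s → occurrences s (xs ∷ʳ x))
              (smallest-≡ (∈-++⁺ʳ xs (here refl)) (All.∷ʳ⁺ x≤xs ≤-refl)))
        (occurrences-∷ʳ x xs)

-- The smallest part of a nonempty list occurs at least once, and the empty list has spread 0, which
-- `1 ≤ j` excludes.
b≡aDiff1 : ∀ {ℓ j} N → 1 ≤ j → b ℓ N j ≡ aDiff 1 ℓ N j
b≡aDiff1 {ℓ} {j} N 1≤j =
  cong length (filter-≐ _ _ ((λ {ps} → to ps) , λ (reg , _ , spr) → reg , spr) (partitions N))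
  where
  to : ∀ ps → Regular ℓ ps × Spread j ps → Regular ℓ ps × SmallestOccurs≥ 1 ps × Spread j ps
  to []       (_   , spr) = contradiction spr (<⇒≢ 1≤j)
  to (p ∷ ps) (reg , spr) = reg , ∈⇒1≤occurrences (smallest-∈ p ps) , spr

-- The bijection between the two families of partitions.

module _ {m ℓ n d : ℕ} (1≤m : 1 ≤ m) (1≤n : 1 ≤ n) (n≤d : n ≤ d) (ℓ∣d : ℓ ∣ d) where

  private
    1≤d = ≤-trans 1≤n n≤d

    x+d≢x : ∀ {x} → x + d ≢ x
    x+d≢x {x} = >⇒≢ (m<m+n x 1≤d)

  -- Named for the map `lower`: `Dom` is what `aDiff m ℓ (n + d) d` counts and `Cod` what
  -- `a (suc m) ℓ n` counts. The bound `m` here is one less than that of the theorem.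
  Dom Cod : List ℕ → Set
  Dom qs = IsPartition (n + d) qs × Regular ℓ qs × SmallestOccurs≥ m qs × Spread d qs
  Cod ps = IsPartition n ps × Regular ℓ ps × SmallestOccurs≥ (suc m) ps

  raise : ∀ is {x} → Cod (is ∷ʳ x) → Dom (x + d ∷ is)
  raise is {x} (isPartition dec pos tot , reg , occ)
    with pairs , x≤is ← AllPairs-∷ʳ⁻ is (decreasing⇒AllPairs dec)
       | posⁱˢ , posˣ ← All.∷ʳ⁻ pos
       | regⁱˢ , regˣ ← All.∷ʳ⁻ {xs = is} reg =
    isPartition (AllPairs⇒Linked (is≤ ∷ pairs)) (≤-trans posˣ (m≤m+n x d) ∷ posⁱˢ) total
    , (λ ℓ∣ → regˣ (∣m+n∣m⇒∣n (subst (ℓ ∣_) (+-comm x d) ℓ∣) ℓ∣d)) ∷ regⁱˢ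
    -- The new part `x + d` differs from `x` because `d` is positive, so it adds no copy of `x`.
    , subst (λ s → m ≤ occurrences s (x + d ∷ is)) (sym smallest≡x)
        (subst (m ≤_) (sym (occurrences-∷-≢ is x+d≢x)) m≤)
    , trans (largest-∷ is≤) (cong (_+ d) (sym smallest≡x))
    where
    sum≡n : sum is + x ≡ n
    sum≡n = trans (sym (sum-∷ʳ is x)) tot

    is≤ : All (_≤ x + d) is
    is≤ = All.tabulate λ {y} y∈ → begin
      y            ≤⟨ ∈⇒≤sum y∈ ⟩
      sum is       ≤⟨ m≤m+n _ x ⟩
      sum is + x   ≡⟨ sum≡n ⟩
      n            ≤⟨ n≤d ⟩
      d            ≤⟨ m≤n+m d x ⟩
      x + d        ∎
      where open ≤-Reasoning

    total : x + d + sum is ≡ n + d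
    total = trans (solve 3 (λ x d s → x :+ d :+ s := s :+ x :+ d) refl x d (sum is))
                  (cong (_+ d) sum≡n)
      where open +-*-Solver

    m≤ : m ≤ occurrences x is
    m≤ = ≤-pred (subst (suc m ≤_) (occurrences-smallest-∷ʳ x≤is) occ)

    -- Since `1 ≤ m`, a copy of `x` is left in `is`, so `x` remains the smallest part.
    smallest≡x : smallest (x + d ∷ is) ≡ x
    smallest≡x = smallest-≡ (there (1≤occurrences⇒∈ is (≤-trans 1≤m m≤))) (m≤m+n x d ∷ x≤is)

  -- The head of a decreasing list is its largest part, so the spread condition determines it.
  Dom-head : ∀ {q qs} → Dom (q ∷ qs) → q ≡ smallest (q ∷ qs) + d
  Dom-head (isPartition dec _ _ , _ , _ , spr)
    with q≥ ∷ _ ← decreasing⇒AllPairs dec = trans (sym (largest-∷ q≥)) spr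

  -- Ensures that the subtraction `q ∸ d` in `lower` does not truncate.
  Dom-d≤ : ∀ {q qs} → Dom (q ∷ qs) → d ≤ q
  Dom-d≤ dom = subst (d ≤_) (sym (Dom-head dom)) (m≤n+m d _)

  -- Writing the head as `x + d` avoids subtraction; by `Dom-head`, `x` is then the smallest part.
  lower-∷ : ∀ {x} is → Dom (x + d ∷ is) → Cod (is ∷ʳ x)
  lower-∷ {x} is dom@(isPartition dec (_ ∷ pos) tot , regˣ ∷ reg , occ , _)
    with _ ∷ pairs ← decreasing⇒AllPairs dec =
    isPartition
      (AllPairs⇒Linked (AllPairs.++⁺ pairs ([] ∷ []) (All.map (_∷ []) x≤is)))
      -- The appended `x` inherits positivity from its copy in `is`.
      (All.∷ʳ⁺ pos (All.lookup pos x∈is))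
      total
    , All.∷ʳ⁺ reg (λ ℓ∣x → regˣ (∣m∣n⇒∣m+n ℓ∣x ℓ∣d))
    , subst (suc m ≤_) (sym (occurrences-smallest-∷ʳ x≤is)) (s≤s m≤)
    where
    smallest≡x : smallest (x + d ∷ is) ≡ x
    smallest≡x = sym (+-cancelʳ-≡ d x _ (Dom-head dom))

    x≤is : All (x ≤_) is
    x≤is = All.tail (subst (λ s → All (s ≤_) (x + d ∷ is)) smallest≡x (smallest-≤ (x + d ∷ is)))

    m≤ : m ≤ occurrences x is
    m≤ = subst (m ≤_) (occurrences-∷-≢ is x+d≢x)
           (subst (λ s → m ≤ occurrences s (x + d ∷ is)) smallest≡x occ)

    x∈is : x ∈ is
    x∈is = 1≤occurrences⇒∈ is (≤-trans 1≤m m≤)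

    total : sum (is ∷ʳ x) ≡ n
    total = +-cancelʳ-≡ d _ n (begin
      sum (is ∷ʳ x) + d   ≡⟨ cong (_+ d) (sum-∷ʳ is x) ⟩
      sum is + x + d      ≡⟨ solve 3 (λ x d s → s :+ x :+ d := x :+ d :+ s) refl x d (sum is) ⟩
      x + d + sum is      ≡⟨ tot ⟩
      n + d               ∎)
      where
      open ≡-Reasoning
      open +-*-Solver

  -- The value at `[]` is a placeholder: the empty list has spread 0, whereas `Dom` requires the
  -- positive spread `d`.
  lower : List ℕ → List ℕ
  lower []       = []
  lower (q ∷ qs) = qs ∷ʳ (q ∸ d)

  lower-Dom : ∀ {qs} → Dom qs → Cod (lower qs)
  lower-Dom {[]} (_ , _ , _ , spr) = contradiction spr (<⇒≢ 1≤d)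
  lower-Dom {q ∷ qs} dom =
    lower-∷ qs (subst (λ q → Dom (q ∷ qs)) (sym (m∸n+n≡m (Dom-d≤ dom))) dom)

  lower-injective : ∀ {ps qs} → Dom ps → Dom qs → lower ps ≡ lower qs → ps ≡ qs
  lower-injective {[]}     {_}      (_ , _ , _ , spr) _ _ = contradiction spr (<⇒≢ 1≤d)
  lower-injective {_ ∷ _}  {[]}     _ (_ , _ , _ , spr) _ = contradiction spr (<⇒≢ 1≤d)
  lower-injective {p ∷ ps} {q ∷ qs} domᵖ domᵠ eq
    with refl , p∸d≡q∸d ← ∷ʳ-injective ps qs eq =
    cong (_∷ ps) (∸-cancelʳ-≡ (Dom-d≤ domᵖ) (Dom-d≤ domᵠ) p∸d≡q∸d)

  lower-surjective : ∀ {ps} → Cod ps → ∃ λ qs → Dom qs × ps ≡ lower qs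
  lower-surjective {ps} cod with initLast ps
  -- In the empty list nothing occurs, so the multiplicity bound `suc m` fails.
  ... | []       = contradiction (proj₂ (proj₂ cod)) λ ()
  ... | is ∷ʳ′ x = x + d ∷ is , raise is cod , cong (is ∷ʳ_) (sym (m+n∸n≡m x d))

  a≡aDiff : a (suc m) ℓ n ≡ aDiff m ℓ (n + d) d
  a≡aDiff = sym (length-bijection lower
    (Unique.filter⁺ dom? (partitions-unique (n + d)))
    (Unique.filter⁺ cod? (partitions-unique n))
    (∈-Cod ∘ lower-Dom ∘ Dom-∈)
    (λ p∈ q∈ → lower-injective (Dom-∈ p∈) (Dom-∈ q∈))
    onto)
    where
    dom? : Decidable λ qs → Regular ℓ qs × SmallestOccurs≥ m qs × Spread d qs
    dom? qs = regular? ℓ qs ×-dec smallestOccurs≥? m qs ×-dec spread? d qs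

    cod? : Decidable λ ps → Regular ℓ ps × SmallestOccurs≥ (suc m) ps
    cod? ps = regular? ℓ ps ×-dec smallestOccurs≥? (suc m) ps

    Dom-∈ : ∀ {qs} → qs ∈ filter dom? (partitions (n + d)) → Dom qs
    Dom-∈ qs∈
      with qs∈ₚ , q ← ∈-filter⁻ dom? {xs = partitions (n + d)} qs∈ = ∈-partitions⁻ qs∈ₚ , q

    ∈-Cod : ∀ {ps} → Cod ps → ps ∈ filter cod? (partitions n)
    ∈-Cod (part , p) = ∈-filter⁺ cod? (∈-partitions⁺ part) p

    onto : ∀ {ps} → ps ∈ filter cod? (partitions n) →
           ∃ λ qs → qs ∈ filter dom? (partitions (n + d)) × ps ≡ lower qs
    onto ps∈
      with ps∈ₚ , p ← ∈-filter⁻ cod? {xs = partitions n} ps∈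
      with qs , (part , q) , eq ← lower-surjective (∈-partitions⁻ ps∈ₚ , p) =
      qs , ∈-filter⁺ dom? (∈-partitions⁺ part) q , eq

-- Divisibility of the shift, and the two cases of the theorem.

∣-round-up : ∀ {ℓ n r} (k : ℤ) → + n ≡ + ℓ ℤ.* k ℤ.+ + r → r ≤ ℓ → ℓ ∣ n + (ℓ ∸ r)
-- In the integers the sum equals `(k + 1) * ℓ`; absolute values give a natural quotient without
-- determining the sign of `k`.
∣-round-up {ℓ} {n} {r} k n≡ r≤ℓ = divides ℤ.∣ ℤ.suc k ∣ (begin
  n + (ℓ ∸ r)             ≡⟨ cong ℤ.∣_∣ eq ⟩
  ℤ.∣ ℤ.suc k ℤ.* + ℓ ∣   ≡⟨ ℤ.abs-* (ℤ.suc k) (+ ℓ) ⟩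
  ℤ.∣ ℤ.suc k ∣ * ℓ       ∎)
  where
  open ≡-Reasoning

  eq : + (n + (ℓ ∸ r)) ≡ ℤ.suc k ℤ.* + ℓ
  eq = begin
    + n ℤ.+ + (ℓ ∸ r)                      ≡⟨ cong (ℤ._+ + (ℓ ∸ r)) n≡ ⟩
    + ℓ ℤ.* k ℤ.+ + r ℤ.+ + (ℓ ∸ r)        ≡⟨ ℤ.+-assoc (+ ℓ ℤ.* k) (+ r) (+ (ℓ ∸ r)) ⟩
    + ℓ ℤ.* k ℤ.+ + (r + (ℓ ∸ r))          ≡⟨ cong (λ x → + ℓ ℤ.* k ℤ.+ + x) (m+[n∸m]≡n r≤ℓ) ⟩
    + ℓ ℤ.* k ℤ.+ + ℓ                      ≡⟨ ℤ.+-comm (+ ℓ ℤ.* k) (+ ℓ) ⟩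
    + ℓ ℤ.+ + ℓ ℤ.* k                      ≡⟨ ℤ.*-suc (+ ℓ) k ⟨
    + ℓ ℤ.* ℤ.suc k                        ≡⟨ ℤ.*-comm (+ ℓ) (ℤ.suc k) ⟩
    ℤ.suc k ℤ.* + ℓ                        ∎

-- The bijection with `d = n + e`, which makes `n ≤ d` automatic. The theorem takes `e = 1` in its
-- first half and `e = ℓ ∸ r` in its second.
a≡aDiff-2n : ∀ {m ℓ n} e → 1 ≤ m → 1 ≤ n → ℓ ∣ n + e →
             a (suc m) ℓ n ≡ aDiff m ℓ (2 * n + e) (n + e)
a≡aDiff-2n {m} {ℓ} {n} e 1≤m 1≤n ℓ∣ =
  trans (a≡aDiff 1≤m 1≤n (m≤m+n n e) ℓ∣)
        (cong (λ N → aDiff m ℓ N (n + e))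
              (solve 2 (λ n e → n :+ (n :+ e) := con 2 :* n :+ e) refl n e))
  where open +-*-Solver

odd⇒2∣1+ : ∀ n → n % 2 ≡ 1 → 2 ∣ n + 1
odd⇒2∣1+ n odd = divides (suc (n / 2)) (begin
  n + 1                     ≡⟨ +-comm n 1 ⟩
  suc n                     ≡⟨ cong suc (m≡m%n+[m/n]*n n 2) ⟩
  suc (n % 2 + n / 2 * 2)   ≡⟨ cong (λ r → suc (r + n / 2 * 2)) odd ⟩
  suc (n / 2) * 2           ∎)
  where open ≡-Reasoning

theorem5p6 : ((n : ℕ) → n ≥ 1 → n % 2 ≡ 1 → a 2 2 n ≡ b 2 (2 * n + 1) (n + 1))
    × ((m ℓ n : ℕ) → m ≥ 2 → ℓ ≥ 2 → n ≥ 1 → ¬ ℓ ∣ n →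
    (k : ℤ) (r : ℕ) → + n ≡ + ℓ ℤ.* k ℤ.+ + r → 1 ≤ r → r < ℓ →
    a m ℓ n ≡ aDiff (m ∸ 1) ℓ (2 * n + (ℓ ∸ r)) (n + (ℓ ∸ r)))
theorem5p6 =
  -- With `ℓ = 2` and multiplicity bound 1 on the right, the positive spread `n + 1` lets `b≡aDiff1`
  -- drop that bound.
  (λ n 1≤n odd → trans (a≡aDiff-2n 1 ≤-refl 1≤n (odd⇒2∣1+ n odd))
                       (sym (b≡aDiff1 (2 * n + 1) (m≤n+m 1 n)))) ,
  λ { (suc m) ℓ n (s≤s 1≤m) _ 1≤n _ k r n≡ _ r<ℓ →
        a≡aDiff-2n (ℓ ∸ r) 1≤m 1≤n (∣-round-up k n≡ (<⇒≤ r<ℓ)) }
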